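{- A permutation $w\in\mathfrak{S}_n$ is unimodal if and only if it avoids both of the patterns $321$ and $3412$.
   Context: $\mathfrak{S}_n$ is the group of permutations of $\{1,\dots,n\}$. A permutation is called unimodal (after Edelman) if the underlying sets of the cycles in its disjoint cycle decomposition are (disjoint) intervals of consecutive integers and each cycle is unimodal. Here a cycle is unimodal if, when written as $(c_1\, c_2\,\cdots\, c_m)$ (meaning $c_1\mapsto c_2\mapsto\cdots\mapsto c_m\mapsto c_1$) with $c_1$ its smallest element, there is an index $r$ with $c_1<c_2<\cdots<c_r>c_{r+1}>\cdots>c_m$. For $p\in\mathfrak{S}_k$, the permutation $w$ contains the pattern $p$ if there are indices $i_1<\cdots<i_k$ such that $w(i_1)\cdots w(i_k)$ is in the same relative order as $p(1)\cdots p(k)$; otherwise $w$ avoids $p$. -}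

module Defs where

open import Data.Nat.Base using (ℕ; suc)
open import Data.Fin.Base using (Fin; toℕ; _<_; _≤_; _>_)
open import Data.Fin.Patterns using (0F; 1F; 2F; 3F)
open import Data.Fin.Permutation using (Permutation′; permutation; _⟨$⟩ʳ_)
open import Data.Fin.Properties using (_≟_; all?)
open import Data.List.Base using (List; []; _∷_; _∷ʳ_; length; take; drop)
open import Data.List.Membership.Propositional using (_∈_)
open import Data.List.Relation.Unary.All using (All)
open import Data.List.Relation.Unary.Linked using (Linked)
open import Data.List.Relation.Unary.Unique.Propositional using (Unique)
open import Data.Product.Base using (_×_; ∃; ∃₂)
open import Data.Vec.Base using (Vec; []; _∷_; lookup)
open import Function.Bundles using (_⇔_)
open import Relation.Binary.Core using (_Preserves_⟶_)
open import Relation.Binary.PropositionalEquality.Core using (_≡_)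
open import Relation.Nullary.Decidable.Core using (from-yes)
open import Relation.Nullary.Negation.Core using (¬_)

-- Permutations of {1,…,n} are represented as permutations of
-- Fin n = {0,…,n-1}; every notion below depends only on the order of
-- the values and on their being consecutive.

private
  variable
    n k : ℕ

-- IsCycle w c₁ [ c₂ , … , cₘ ]: the cycle (c₁ c₂ ⋯ cₘ) occurs in the
-- disjoint cycle decomposition of w, that is, the cᵢ are distinct and
-- w maps c₁ ↦ c₂ ↦ ⋯ ↦ cₘ ↦ c₁.  Fixed points are the cycles with m = 1,
-- and a cycle of length m is written in m ways, one for each choice of c₁.

IsCycle : Permutation′ n → Fin n → List (Fin n) → Set
IsCycle w c₁ cs =
  Unique (c₁ ∷ cs) × Linked (λ x y → w ⟨$⟩ʳ x ≡ y) ((c₁ ∷ cs) ∷ʳ c₁)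

IsInterval : List (Fin n) → Set
IsInterval {n} c =
  ∃₂ λ (a b : Fin n) → (x : Fin n) → x ∈ c ⇔ (a ≤ x × x ≤ b)

-- The peak cᵣ, at 0-based position r, belongs to both runs.

IsUnimodalSequence : List (Fin n) → Set
IsUnimodalSequence c =
  ∃ λ (r : Fin (length c)) →
    Linked _<_ (take (suc (toℕ r)) c) × Linked _>_ (drop (toℕ r) c)

-- The condition on the sequence is imposed only on the writing of the
-- cycle that starts with its smallest element.

Unimodal : Permutation′ n → Set
Unimodal {n} w =
  (c₁ : Fin n) (cs : List (Fin n)) → IsCycle w c₁ cs →
  IsInterval (c₁ ∷ cs) × (All (c₁ ≤_) cs → IsUnimodalSequence (c₁ ∷ cs))

Contains : Permutation′ n → Permutation′ k → Set
Contains {n} {k} w p =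
  ∃ λ (i : Fin k → Fin n) →
    i Preserves _<_ ⟶ _<_ ×
    ((a b : Fin k) → (w ⟨$⟩ʳ i a < w ⟨$⟩ʳ i b) ⇔ (p ⟨$⟩ʳ a < p ⟨$⟩ʳ b))

Avoids : Permutation′ n → Permutation′ k → Set
Avoids w p = ¬ Contains w p

-- The patterns are given in one-line notation with values shifted down
-- by one.  Both are involutions, so each is its own inverse.

pattern321 : Permutation′ 3
pattern321 = permutation p p p∘p p∘p
  where
  p : Fin 3 → Fin 3
  p = lookup (2F ∷ 1F ∷ 0F ∷ [])

  p∘p : ∀ i → p (p i) ≡ i
  p∘p = from-yes (all? λ i → p (p i) ≟ i)

pattern3412 : Permutation′ 4
pattern3412 = permutation p p p∘p p∘p
  where
  p : Fin 4 → Fin 4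
  p = lookup (2F ∷ 3F ∷ 0F ∷ 1F ∷ [])

  p∘p : ∀ i → p (p i) ≡ i
  p∘p = from-yes (all? λ i → p (p i) ≟ i)

{-# OPTIONS --safe #-}
module Submission where

-- Both sides are equivalent to the following condition on w: if x < y are
-- exceedances (w(x) > x, w(y) > y) then w(x) ≤ y, and if x < y are
-- non-exceedances then x ≤ w(y).
--
-- In a unimodal cycle the exceedances form the increasing run and the
-- non-exceedances the decreasing one, which gives the condition.
-- Conversely, a point x outside a cycle that surrounds it cannot be crossed
-- by the cycle upwards if x is an exceedance, nor downwards otherwise; and an
-- exceedance other than the minimum of its cycle is preceded in the cycle
-- only by smaller elements, so that no ascent follows a descent.
--
-- An occurrence of either pattern violates the condition.  Conversely, if
-- two elements of a set are mapped out of it, then two elements outside are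
-- mapped into it; for the sets {≤ y} and {≥ x} these elements, together with
-- a violating pair x < y, form one of the patterns (if x is fixed, one element
-- entering {≥ x} is enough).

open import Defs
open import Data.Nat.Base as ℕ using (ℕ; zero; suc; z≤n; s≤s)
import Data.Nat.Properties as ℕ
open import Data.Fin.Base using (Fin; zero; suc; toℕ; _<_; _≤_; _>_)
open import Data.Fin.Patterns using (0F; 1F; 2F; 3F)
open import Data.Fin.Permutation using (Permutation′; _⟨$⟩ʳ_; _⟨$⟩ˡ_; inverseʳ; _∘ₚ_; transpose)
open import Data.Fin.Properties using (_≟_; _≤?_; _<?_; any?; <-cmp; ≤-totalOrder; ≤∧≢⇒<; injective⇒≤)
open import Data.List.Base using (List; []; _∷_; _∷ʳ_; length; lookup)
import Data.List.Extrema
open import Data.List.Membership.Propositional using (_∈_; _∉_)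
open import Data.List.Membership.Propositional.Properties using (∈-++⁻; ∈-lookup)
open import Data.List.Relation.Unary.All as All using (All; []; _∷_)
open import Data.List.Relation.Unary.All.Properties using (¬Any⇒All¬; All¬⇒¬Any)
open import Data.List.Relation.Unary.AllPairs using (AllPairs; []; _∷_)
open import Data.List.Relation.Unary.Any as Any using (here; there)
open import Data.List.Relation.Unary.Linked as Linked using (Linked; []; [-]; _∷_)
open import Data.List.Relation.Unary.Linked.Properties using (Linked⇒AllPairs)
open import Data.List.Relation.Unary.Unique.Propositional using (Unique)
open import Data.Product.Base using (_×_; _,_; ∃; ∃₂; proj₁; proj₂; uncurry)
open import Data.Sum.Base using (inj₁; inj₂)
open import Data.Vec.Base as Vec using (Vec; []; _∷_)
import Data.Vec.Relation.Unary.Linked as VecLinked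
import Data.Vec.Relation.Unary.Linked.Properties as VecLinked
open import Function.Base using (id; _∘_)
open import Function.Bundles using (_⇔_; mk⇔; Equivalence; Injection)
open import Function.Properties.Inverse using (↔⇒↣)
open import Level using (0ℓ)
open import Relation.Binary.Definitions using (Tri; tri<; tri≈; tri>)
open import Relation.Binary.PropositionalEquality
open import Relation.Nullary.Decidable using (Dec; yes; no; ¬?; _×-dec_)
open import Relation.Nullary.Negation using (¬_; contradiction)
open import Relation.Unary using (Pred; Decidable)

module Extrema {n : ℕ} = Data.List.Extrema (≤-totalOrder n)

private
  variable
    n k : ℕ

-- Injectivity, distinct lists and intervals.

permutation-injective : (w : Permutation′ n) {x y : Fin n} → w ⟨$⟩ʳ x ≡ w ⟨$⟩ʳ y → x ≡ y
permutation-injective w = Injection.injective (↔⇒↣ w)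

lookup-injective : {A : Set} {xs : List A} → Unique xs →
                   ∀ {i j} → lookup xs i ≡ lookup xs j → i ≡ j
lookup-injective (_ ∷ _) {zero} {zero} _ = refl
lookup-injective (x∉ ∷ _) {zero} {suc j} eq = contradiction eq (All.lookup x∉ (∈-lookup j))
lookup-injective (x∉ ∷ _) {suc i} {zero} eq = contradiction (sym eq) (All.lookup x∉ (∈-lookup i))
lookup-injective (_ ∷ u) {suc i} {suc j} eq = cong suc (lookup-injective u eq)

unique-length : {xs : List (Fin n)} → Unique xs → length xs ℕ.≤ n
unique-length u = injective⇒≤ (lookup-injective u)

interval-convex : {xs : List (Fin n)} {x y z : Fin n} → IsInterval xs →
                  x ∈ xs → z ∈ xs → x ≤ y → y ≤ z → y ∈ xs
interval-convex {x = x} {y} {z} (a , b , interval) x∈ z∈ x≤y y≤z = Equivalence.from (interval y)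
  ( ℕ.≤-trans (proj₁ (Equivalence.to (interval x) x∈)) x≤y
  , ℕ.≤-trans y≤z (proj₂ (Equivalence.to (interval z) z∈)))

-- Cycles

module _ (w : Permutation′ n) where

  private
    f : Fin n → Fin n
    f = w ⟨$⟩ʳ_

  Path : List (Fin n) → Set
  Path = Linked (λ x y → f x ≡ y)

  path-step : ∀ c cs {e y} → Path ((c ∷ cs) ∷ʳ e) → y ∈ c ∷ cs → f y ∈ cs ∷ʳ e
  path-step c [] (eq ∷ _) (here refl) = here eq
  path-step c (_ ∷ _) (eq ∷ _) (here refl) = here eq
  path-step c (d ∷ ds) (_ ∷ p) (there y∈) = there (path-step d ds p y∈)

  cycle-step : ∀ {c cs y} → IsCycle w c cs → y ∈ c ∷ cs → f y ∈ c ∷ cs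
  cycle-step {c} {cs} (_ , p) y∈ with ∈-++⁻ cs (path-step c cs p y∈)
  ... | inj₁ fy∈cs = there fy∈cs
  ... | inj₂ (here fy≡c) = here fy≡c

  module _ {Q : Pred (Fin n) 0ℓ} where

    path-closed-end : ∀ c cs {e z} → Path ((c ∷ cs) ∷ʳ e) →
                      (∀ {y} → y ∈ c ∷ cs → Q y → Q (f y)) →
                      z ∈ c ∷ cs → Q z → Q e
    path-closed-end c [] (refl ∷ _) closed z∈@(here refl) Qz = closed z∈ Qz
    path-closed-end c (d ∷ ds) (refl ∷ p) closed z∈@(here refl) Qz =
      path-closed-end d ds p (closed ∘ there) (here refl) (closed z∈ Qz)
    path-closed-end c (d ∷ ds) (_ ∷ p) closed (there z∈) Qz =
      path-closed-end d ds p (closed ∘ there) z∈ Qz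

    path-closed : ∀ c cs {e y} → Path ((c ∷ cs) ∷ʳ e) →
                  (∀ {y} → y ∈ c ∷ cs → Q y → Q (f y)) →
                  Q c → y ∈ c ∷ cs → Q y
    path-closed c cs p closed Qc (here refl) = Qc
    path-closed c (d ∷ ds) (refl ∷ p) closed Qc (there y∈) =
      path-closed d ds p (closed ∘ there) (closed (here refl) Qc) y∈

    -- From `z` the property travels to the closing copy of `c`, and from there along the whole
    -- cycle.
    cycle-closed : ∀ {c cs z y} → IsCycle w c cs →
                   (∀ {y} → y ∈ c ∷ cs → Q y → Q (f y)) →
                   z ∈ c ∷ cs → Q z → y ∈ c ∷ cs → Q y
    cycle-closed (_ , p) closed z∈ Qz =
      path-closed _ _ p closed (path-closed-end _ _ p closed z∈ Qz)

  -- The path is grown backwards, so that injectivity of w makes the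
  -- predecessor of its head new unless the path already starts at x.
  close-path : ∀ m {x} c cs → n ℕ.< m ℕ.+ length (c ∷ cs) →
               Unique (c ∷ cs) → Path ((c ∷ cs) ∷ʳ x) → ∃ (IsCycle w x)
  -- `m` is fuel: once it is spent, the path would have more than `n` distinct entries.
  close-path zero c cs n< u p = contradiction (unique-length u) (ℕ.<⇒≱ n<)
  close-path (suc m) {x} c cs n< u p with c ≟ x
  ... | yes refl = cs , u , p
  ... | no c≢x = close-path m d (c ∷ cs)
          (subst (n ℕ.<_) (sym (ℕ.+-suc m (suc (length cs)))) n<)
          (¬Any⇒All¬ _ d∉ ∷ u) (inverseʳ w ∷ p)
    where
    d = w ⟨$⟩ˡ c

    head-not-image : ∀ {d} c cs → Unique (c ∷ cs) → c ≢ x → Path ((c ∷ cs) ∷ʳ x) →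
                     f d ≡ c → d ∉ c ∷ cs
    head-not-image c cs (c∉ ∷ _) c≢x p refl d∈ with ∈-++⁻ cs (path-step c cs p d∈)
    ... | inj₁ c∈ = All¬⇒¬Any c∉ c∈
    ... | inj₂ (here c≡x) = c≢x c≡x

    d∉ : d ∉ c ∷ cs
    d∉ = head-not-image c cs u c≢x p (inverseʳ w)

  cycle-through : ∀ x → ∃ (IsCycle w x)
  cycle-through x = close-path n (w ⟨$⟩ˡ x) []
    (subst (n ℕ.<_) (ℕ.+-comm 1 n) ℕ.≤-refl) ([] ∷ []) (inverseʳ w ∷ [-])

  ExceedancesApart : Set
  ExceedancesApart = ∀ {x y} → x < y → x < f x → y < f y → f x ≤ y

  NonExceedancesApart : Set
  NonExceedancesApart = ∀ {x y} → x < y → f x ≤ x → f y ≤ y → x ≤ f y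

  -- From separated exceedances to unimodal cycles

  module _ (exc : ExceedancesApart) where

    -- The successor `y = f x` is below `x`, while later exceedances are above `x`; so `y` is again
    -- a non-exceedance and the descent goes on.
    descending : ∀ x cs {e} → Unique (x ∷ cs) → Path ((x ∷ cs) ∷ʳ e) →
                 All (λ v → v < f v → x < v) cs → f x ≤ x →
                 Linked _>_ (x ∷ cs)
    descending x [] _ _ _ _ = [-]
    descending x (y ∷ ys) ((x≢y ∷ _) ∷ u) (refl ∷ p) (ty ∷ tys) fx≤x =
      y<x ∷ descending y ys u p
        (All.map (λ t e → ℕ.<-trans y<x (t e)) tys)
        (ℕ.≮⇒≥ (λ y<fy → ℕ.<-asym y<x (ty y<fy)))
      where
      y<x : y < x
      y<x = ≤∧≢⇒< fx≤x (x≢y ∘ sym)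

    -- The bound on later exceedances is the invariant of the induction. It is clear at the minimum
    -- of a cycle, and it makes everything after the first non-exceedance descend.
    unimodal-sequence : ∀ x cs {e} → Unique (x ∷ cs) → Path ((x ∷ cs) ∷ʳ e) →
                        All (λ v → v < f v → x < v) cs →
                        IsUnimodalSequence (x ∷ cs)
    unimodal-sequence x [] _ _ _ = zero , [-] , [-]
    unimodal-sequence x (y ∷ ys) u@(_ ∷ u′@(y∉ys ∷ _)) p@(refl ∷ p′) t@(_ ∷ tys) with x <? f x
    ... | no x≮fx = zero , [-] , descending x (y ∷ ys) u p t (ℕ.≮⇒≥ x≮fx)
    -- For a later exceedance `v`, `exc` gives `y = f x ≤ v`, and distinctness makes this strict.
    ... | yes x<fx with unimodal-sequence y ys u′ p′ (All.zipWith
            (λ (y≢v , t) v<fv → ≤∧≢⇒< (exc (t v<fv) x<fx v<fv) y≢v) (y∉ys , tys))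
    ...   | r , up , down = suc r , x<fx ∷ up , down

  module _ (exc : ExceedancesApart) (non : NonExceedancesApart) where

    cycle-convex : ∀ {c cs a b x} → IsCycle w c cs → a ∈ c ∷ cs → b ∈ c ∷ cs →
                   a ≤ x → x ≤ b → x ∈ c ∷ cs
    cycle-convex {c} {cs} {a} {b} {x} cyc a∈ b∈ a≤x x≤b
      with Any.any? (x ≟_) (c ∷ cs)
    ... | yes x∈ = x∈
    ... | no x∉ with x <? f x
    ...   | yes x<fx = contradiction x≤b (ℕ.<⇒≱
              (cycle-closed cyc stays a∈ (≤∧≢⇒< a≤x λ { refl → x∉ a∈ }) b∈))
      where
      stays : ∀ {y} → y ∈ c ∷ cs → y < x → f y < x
      stays {y} y∈ y<x with y <? f y
      ... | yes y<fy = ≤∧≢⇒< (exc y<x y<fy x<fx) λ fy≡x → x∉ (subst (_∈ _) fy≡x (cycle-step cyc y∈))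
      ... | no y≮fy = ℕ.≤-<-trans (ℕ.≮⇒≥ y≮fy) y<x
    ...   | no x≮fx = contradiction a≤x (ℕ.<⇒≱
              (cycle-closed cyc stays b∈ (≤∧≢⇒< x≤b λ { refl → x∉ b∈ }) a∈))
      where
      stays : ∀ {y} → y ∈ c ∷ cs → x < y → x < f y
      stays {y} y∈ x<y with y <? f y
      ... | yes y<fy = ℕ.<-trans x<y y<fy
      ... | no y≮fy = ≤∧≢⇒< (non x<y (ℕ.≮⇒≥ x≮fx) (ℕ.≮⇒≥ y≮fy))
              λ x≡fy → x∉ (subst (_∈ _) (sym x≡fy) (cycle-step cyc y∈))

    cycle-interval : ∀ {c cs} → IsCycle w c cs → IsInterval (c ∷ cs)
    cycle-interval {c} {cs} cyc = lo , hi , λ x → mk⇔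
      (λ x∈ → All.lookup (Extrema.min≤⊤ c cs ∷ Extrema.min≤xs c cs) x∈ ,
              All.lookup (Extrema.⊥≤max c cs ∷ Extrema.xs≤max c cs) x∈)
      (uncurry (cycle-convex cyc
        (Extrema.argmin-all id (here refl) (All.tabulate there))
        (Extrema.argmax-all id (here refl) (All.tabulate there))))
      where
      lo = Extrema.min c cs
      hi = Extrema.max c cs

    apart⇒unimodal : Unimodal w
    apart⇒unimodal c cs cyc@(u@(c∉cs ∷ _) , p) = cycle-interval cyc , λ c≤cs →
      unimodal-sequence exc c cs u p
        (All.zipWith (λ (c≤v , c≢v) _ → ≤∧≢⇒< c≤v c≢v) (c≤cs , c∉cs))

  -- From unimodal cycles to separated exceedances

  -- A pairwise form of unimodality, for `u` before `v` in the writing from the minimum, that does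
  -- not mention the peak.
  Precedes : Fin n → Fin n → Set
  Precedes u v = (v < f v → u < v) × (f u ≤ u → v < u)

  -- The last element returns to `e`, in the application the minimum of the cycle, so it is a
  -- non-exceedance as well.
  descending-step : ∀ c cs {e} → Path ((c ∷ cs) ∷ʳ e) → All (e ≤_) (c ∷ cs) →
                    Linked _>_ (c ∷ cs) → All (λ v → f v ≤ v) (c ∷ cs)
  descending-step c [] (refl ∷ _) (e≤c ∷ _) _ = e≤c ∷ []
  descending-step c (d ∷ ds) (refl ∷ p) (_ ∷ e≤) (d<c ∷ down) =
    ℕ.<⇒≤ d<c ∷ descending-step d ds p e≤ down

  descending-precedes : ∀ {cs} → All (λ v → f v ≤ v) cs → AllPairs _>_ cs →
                        AllPairs Precedes cs
  descending-precedes [] [] = []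
  descending-precedes (_ ∷ steps) (c> ∷ down) =
    All.zipWith (λ (fv≤v , v<c) → (λ v<fv → contradiction fv≤v (ℕ.<⇒≱ v<fv)) , λ _ → v<c)
      (steps , c>)
    ∷ descending-precedes steps down

  -- Induction on the position of the peak. Before the peak `c` is an exceedance, so the second half
  -- of `Precedes` is vacuous; the first follows from `c < d` and the bounds for `d`.
  unimodal-precedes : ∀ c cs {e} → Path ((c ∷ cs) ∷ʳ e) → All (e ≤_) (c ∷ cs) →
                      IsUnimodalSequence (c ∷ cs) → AllPairs Precedes (c ∷ cs)
  unimodal-precedes c cs p e≤ (zero , _ , down) =
    descending-precedes (descending-step c cs p e≤ down)
      (Linked⇒AllPairs (λ i>j j>k → ℕ.<-trans j>k i>j) down)
  unimodal-precedes c (d ∷ ds) (refl ∷ p) (_ ∷ e≤) (suc r , c<d ∷ up , down)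
    with unimodal-precedes d ds p e≤ (r , up , down)
  ... | prec@(d-prec ∷ _) =
    (((λ _ → c<d) , descent) ∷ All.map (λ (t , _) → (λ e → ℕ.<-trans c<d (t e)) , descent) d-prec)
    ∷ prec
    where
    descent : ∀ {v} → d ≤ c → v < c
    descent d≤c = contradiction d≤c (ℕ.<⇒≱ c<d)

  -- `Precedes` forces `x` to come before `y`. The next element `f x` is then `y` itself or still
  -- precedes the exceedance `y`.
  precedes⇒exceedances : ∀ c cs {e x y} → Path ((c ∷ cs) ∷ʳ e) → AllPairs Precedes (c ∷ cs) →
    x ∈ c ∷ cs → y ∈ c ∷ cs → x < y → x < f x → y < f y → f x ≤ y
  precedes⇒exceedances c cs p prec (here refl) (here refl) x<y _ _ = contradiction x<y (ℕ.<-irrefl refl)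
  precedes⇒exceedances c (d ∷ ds) (refl ∷ p) _ (here refl) (there (here refl)) _ _ _ = ℕ.≤-refl
  precedes⇒exceedances c (d ∷ ds) (refl ∷ p) (_ ∷ d-prec ∷ _) (here refl) (there (there y∈)) _ _ y<fy =
    ℕ.<⇒≤ (proj₁ (All.lookup d-prec y∈) y<fy)
  precedes⇒exceedances c cs p (c-prec ∷ _) (there x∈) (here refl) x<y x<fx _ =
    contradiction (proj₁ (All.lookup c-prec x∈) x<fx) (ℕ.<-asym x<y)
  precedes⇒exceedances c (d ∷ ds) (_ ∷ p) (_ ∷ prec) (there x∈) (there y∈) =
    precedes⇒exceedances d ds p prec x∈ y∈

  -- Here `y` must come before `x`, and `f y` is `x` or a non-exceedance preceding `x`.
  precedes⇒nonExceedances : ∀ c cs {e x y} → Path ((c ∷ cs) ∷ʳ e) → AllPairs Precedes (c ∷ cs) →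
    x ∈ c ∷ cs → y ∈ c ∷ cs → x < y → f x ≤ x → f y ≤ y → x ≤ f y
  precedes⇒nonExceedances c cs p prec (here refl) (here refl) x<y _ _ = contradiction x<y (ℕ.<-irrefl refl)
  precedes⇒nonExceedances c cs p (c-prec ∷ _) (here refl) (there y∈) x<y fx≤x _ =
    contradiction (proj₂ (All.lookup c-prec y∈) fx≤x) (ℕ.<-asym x<y)
  precedes⇒nonExceedances c (d ∷ ds) (refl ∷ p) _ (there (here refl)) (here refl) _ _ _ = ℕ.≤-refl
  precedes⇒nonExceedances c (d ∷ ds) (refl ∷ p) ((c-d ∷ _) ∷ d-prec ∷ _) (there (there x∈)) (here refl) _ _ d≤c =
    -- Were `d` an exceedance, `c < d` would contradict `d = f c ≤ c`.
    ℕ.<⇒≤ (proj₂ (All.lookup d-prec x∈) (ℕ.≮⇒≥ λ d<fd → contradiction d≤c (ℕ.<⇒≱ (proj₁ c-d d<fd))))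
  precedes⇒nonExceedances c (d ∷ ds) (_ ∷ p) (_ ∷ prec) (there x∈) (there y∈) =
    precedes⇒nonExceedances d ds p prec x∈ y∈

  module _ (uni : Unimodal w) where

    -- The shape of a cycle is known only when it is written from its minimum, so the cycle of `x`
    -- is rewritten from the left endpoint `a` of its interval.
    cycle-with-precedence : ∀ x → ∃₂ λ c cs → IsCycle w c cs × x ∈ c ∷ cs ×
      IsInterval (c ∷ cs) × AllPairs Precedes (c ∷ cs)
    cycle-with-precedence x with cycle-through x
    ... | cs₀ , cyc₀ with proj₁ (uni x cs₀ cyc₀)
    ...   | a , b , interval with cycle-through a
    ...     | cs , cyc@(_ , p) = a , cs , cyc , x∈ , proj₁ (uni a cs cyc) ,
                unimodal-precedes a cs p (ℕ.≤-refl ∷ a≤cs) (proj₂ (uni a cs cyc) a≤cs)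
      where
      a≤x≤b : a ≤ x × x ≤ b
      a≤x≤b = Equivalence.to (interval x) (here refl)

      a∈ : a ∈ x ∷ cs₀
      a∈ = Equivalence.from (interval a) (ℕ.≤-refl , uncurry ℕ.≤-trans a≤x≤b)

      x∈ : x ∈ a ∷ cs
      x∈ = cycle-closed {Q = _∈ a ∷ cs} cyc₀ (λ _ → cycle-step cyc) a∈ (here refl) (here refl)

      a≤cs : All (a ≤_) cs
      a≤cs = All.tabulate λ {y} y∈ → proj₁ (Equivalence.to (interval y)
        (cycle-closed {Q = _∈ x ∷ cs₀} cyc (λ _ → cycle-step cyc₀) (here refl) a∈ (there y∈)))

    -- If `y < f x`, then `y` lies between `x` and `f x`, so convexity puts it in the cycle of `x`.
    unimodal⇒exceedancesApart : ExceedancesApart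
    unimodal⇒exceedancesApart {x} {y} x<y x<fx y<fy with cycle-with-precedence x
    ... | c , cs , cyc@(_ , p) , x∈ , interval , prec = ℕ.≮⇒≥ λ y<fx → ℕ.<⇒≱ y<fx
      (precedes⇒exceedances c cs p prec x∈
        (interval-convex interval x∈ (cycle-step cyc x∈) (ℕ.<⇒≤ x<y) (ℕ.<⇒≤ y<fx)) x<y x<fx y<fy)

    unimodal⇒nonExceedancesApart : NonExceedancesApart
    unimodal⇒nonExceedancesApart {x} {y} x<y fx≤x fy≤y with cycle-with-precedence y
    ... | c , cs , cyc@(_ , p) , y∈ , interval , prec = ℕ.≮⇒≥ λ fy<x → ℕ.<⇒≱ fy<x
      (precedes⇒nonExceedances c cs p prec
        (interval-convex interval (cycle-step cyc y∈) y∈ (ℕ.<⇒≤ fy<x) (ℕ.<⇒≤ x<y)) y∈ x<y fx≤x fy≤y)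

  -- Patterns 321 and 3412

  module _ (exc : ExceedancesApart) (non : NonExceedancesApart) where

    -- If the middle position `j` is an exceedance, so is `i`; otherwise `k` is a non-exceedance.
    -- Either pair violates the condition.
    apart⇒no321 : ∀ {i j k} → i < j → j < k → f k < f j → ¬ (f j < f i)
    apart⇒no321 {i} {j} {k} i<j j<k fk<fj fj<fi with j <? f j
    ... | yes j<fj = ℕ.<⇒≱ fj<fi (ℕ.≤-trans
            (exc i<j (ℕ.<-trans i<j (ℕ.<-trans j<fj fj<fi)) j<fj) (ℕ.<⇒≤ j<fj))
    ... | no j≮fj = ℕ.<⇒≱ (ℕ.<-≤-trans fk<fj fj≤j) (non j<k fj≤j
            (ℕ.<⇒≤ (ℕ.<-trans (ℕ.<-≤-trans fk<fj fj≤j) j<k)))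
      where fj≤j = ℕ.≮⇒≥ j≮fj

    -- An exceedance at `k` or `l` clashes with `i`. If there is none, `k ≤ f l`, which makes `i`
    -- and `j` clashing exceedances.
    apart⇒no3412 : ∀ {i j k l} → i < j → j < k → k < l →
                   f k < f l → f l < f i → ¬ (f i < f j)
    apart⇒no3412 {i} {j} {k} {l} i<j j<k k<l fk<fl fl<fi fi<fj with k <? f k
    ... | yes k<fk = ℕ.<⇒≱ k<fi (exc i<k (ℕ.<-trans i<k k<fi) k<fk)
      where
      i<k = ℕ.<-trans i<j j<k
      k<fi = ℕ.<-trans k<fk (ℕ.<-trans fk<fl fl<fi)
    ... | no k≮fk with l <? f l
    ...   | yes l<fl = ℕ.<⇒≱ l<fi (exc i<l (ℕ.<-trans i<l l<fi) l<fl)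
      where
      i<l = ℕ.<-trans i<j (ℕ.<-trans j<k k<l)
      l<fi = ℕ.<-trans l<fl fl<fi
    ...   | no l≮fl = ℕ.<⇒≱ j<fi (exc i<j (ℕ.<-trans i<j j<fi) (ℕ.<-trans j<fi fi<fj))
      where
      j<fi = ℕ.<-trans (ℕ.<-≤-trans j<k (non k<l (ℕ.≮⇒≥ k≮fk) (ℕ.≮⇒≥ l≮fl))) fl<fi

    apart⇒avoids321 : Avoids w pattern321
    apart⇒avoids321 (i , mono , rel) = apart⇒no321
      (mono {0F} {1F} (s≤s z≤n)) (mono {1F} {2F} (s≤s (s≤s z≤n)))
      (Equivalence.from (rel 2F 1F) (s≤s z≤n)) (Equivalence.from (rel 1F 0F) (s≤s (s≤s z≤n)))

    apart⇒avoids3412 : Avoids w pattern3412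
    apart⇒avoids3412 (i , mono , rel) = apart⇒no3412
      (mono {0F} {1F} (s≤s z≤n)) (mono {1F} {2F} (s≤s (s≤s z≤n)))
      (mono {2F} {3F} (s≤s (s≤s (s≤s z≤n))))
      (Equivalence.from (rel 2F 3F) (s≤s z≤n)) (Equivalence.from (rel 3F 0F) (s≤s (s≤s z≤n)))
      (Equivalence.from (rel 0F 1F) (s≤s (s≤s (s≤s z≤n))))

  -- With `vs` the values in increasing order, `p` gives ranks and an occurrence reduces to two
  -- chains.
  contains : (p : Permutation′ k) (is vs : Vec (Fin n) k) →
             VecLinked.Linked _<_ is → VecLinked.Linked _<_ vs →
             (∀ a → Vec.lookup vs (p ⟨$⟩ʳ a) ≡ f (Vec.lookup is a)) → Contains w p
  contains p is vs is↗ vs↗ vs≡ = Vec.lookup is , VecLinked.lookup⁺ ℕ.<-trans is↗ ,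
    λ a b → mk⇔ (reflect a b) (preserve a b)
    where
    preserve : ∀ a b → p ⟨$⟩ʳ a < p ⟨$⟩ʳ b → f (Vec.lookup is a) < f (Vec.lookup is b)
    preserve a b pa<pb = subst₂ _<_ (vs≡ a) (vs≡ b) (VecLinked.lookup⁺ ℕ.<-trans vs↗ pa<pb)

    reflect : ∀ a b → f (Vec.lookup is a) < f (Vec.lookup is b) → p ⟨$⟩ʳ a < p ⟨$⟩ʳ b
    reflect a b lt with <-cmp (p ⟨$⟩ʳ a) (p ⟨$⟩ʳ b)
    ... | tri< pa<pb _ _ = pa<pb
    ... | tri≈ _ pa≡pb _ = contradiction lt
            (ℕ.<-irrefl (cong (toℕ ∘ f ∘ Vec.lookup is) (permutation-injective p pa≡pb)))
    ... | tri> _ _ pb<pa = contradiction (preserve b a pb<pa) (ℕ.<-asym lt)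

  contains321 : ∀ {i j k} → i < j → j < k → f k < f j → f j < f i → Contains w pattern321
  contains321 {i} {j} {k} i<j j<k fk<fj fj<fi =
    contains pattern321 (i ∷ j ∷ k ∷ []) (f k ∷ f j ∷ f i ∷ [])
      (i<j VecLinked.∷ j<k VecLinked.∷ VecLinked.[-])
      (fk<fj VecLinked.∷ fj<fi VecLinked.∷ VecLinked.[-])
      λ { 0F → refl ; 1F → refl ; 2F → refl }

  contains3412 : ∀ {i j k l} → i < j → j < k → k < l →
                 f k < f l → f l < f i → f i < f j → Contains w pattern3412
  contains3412 {i} {j} {k} {l} i<j j<k k<l fk<fl fl<fi fi<fj =
    contains pattern3412 (i ∷ j ∷ k ∷ l ∷ []) (f k ∷ f l ∷ f i ∷ f j ∷ [])
      (i<j VecLinked.∷ j<k VecLinked.∷ k<l VecLinked.∷ VecLinked.[-])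
      (fk<fl VecLinked.∷ fl<fi VecLinked.∷ fi<fj VecLinked.∷ VecLinked.[-])
      λ { 0F → refl ; 1F → refl ; 2F → refl ; 3F → refl }

-- Elements entering a set that others leave.

transpose-unmoved : {i j z : Fin n} → z ≢ i → z ≢ j → transpose i j ⟨$⟩ʳ z ≡ z
transpose-unmoved {i = i} {j} {z} z≢i z≢j with z ≟ i
... | yes z≡i = contradiction z≡i z≢i
... | no _ with z ≟ j
...   | yes z≡j = contradiction z≡j z≢j
...   | no _ = refl

transpose-second : (i j : Fin n) → transpose i j ⟨$⟩ʳ j ≡ i
transpose-second i j with j ≟ i
... | yes j≡i = j≡i
... | no _ with j ≟ j
...   | yes _ = refl
...   | no j≢j = contradiction refl j≢j

-- If nothing entered `P`, its complement would be closed along the cycle of `x`, which contains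
-- `f x`, and so would contain `x`.
one-return : (w : Permutation′ n) {P : Pred (Fin n) 0ℓ} → Decidable P →
             ∀ {x} → P x → ¬ P (w ⟨$⟩ʳ x) → ∃ λ k → ¬ P k × P (w ⟨$⟩ʳ k)
one-return w {P} P? {x} Px ¬Pfx with any? (λ k → ¬? (P? k) ×-dec P? (w ⟨$⟩ʳ k))
... | yes found = found
... | no none with cycle-through w x
...   | cs , cyc = contradiction Px (cycle-closed w {Q = ¬_ ∘ P} cyc
          (λ {y} _ ¬Py Pfy → none (y , ¬Py , Pfy))
          (cycle-step w cyc (here refl)) ¬Pfx (here refl))

module _ (w : Permutation′ n) where

  private
    f : Fin n → Fin n
    f = w ⟨$⟩ʳ_

  module _ {P : Pred (Fin n) 0ℓ} (P? : Decidable P) where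

    -- Exchanging the values at x and at a first return k gives a
    -- permutation that still leaves P at y, but no longer enters P at k.
    two-returns : ∀ {x y} → x ≢ y → P x → ¬ P (f x) → P y → ¬ P (f y) →
      ∃₂ λ k l → k < l × (¬ P k × P (f k)) × (¬ P l × P (f l))
    two-returns {x} {y} x≢y Px ¬Pfx Py ¬Pfy with one-return w P? Px ¬Pfx
    ... | k , ¬Pk , Pfk with one-return (w ∘ₚ transpose (f x) (f k)) P? Py
            (subst (¬_ ∘ P) (sym (transpose-unmoved (x≢y ∘ sym ∘ permutation-injective w)
              (λ fy≡fk → ¬Pfy (subst P (sym fy≡fk) Pfk)))) ¬Pfy)
    ...   | l , ¬Pl , Pf′l = order (<-cmp k l)
      where
      k≢l : k ≢ l
      k≢l refl = ¬Pfx (subst P (transpose-second (f x) (f k)) Pf′l)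

      Pfl : P (f l)
      Pfl = subst P (transpose-unmoved
        (λ fl≡fx → ¬Pl (subst P (sym (permutation-injective w fl≡fx)) Px))
        (k≢l ∘ sym ∘ permutation-injective w)) Pf′l

      order : Tri (k < l) (k ≡ l) (l < k) → ∃₂ λ k l → k < l × (¬ P k × P (f k)) × (¬ P l × P (f l))
      order (tri< k<l _ _) = k , l , k<l , (¬Pk , Pfk) , (¬Pl , Pfl)
      order (tri≈ _ k≡l _) = contradiction k≡l k≢l
      order (tri> _ _ l<k) = l , k , l<k , (¬Pl , Pfl) , (¬Pk , Pfk)

  -- From pattern avoidance to separated exceedances.

  module _ (no321 : Avoids w pattern321) (no3412 : Avoids w pattern3412) where

    -- For `k < l` entering the elements at most `y`, a descent `f l < f k` gives 321 with `x`, a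
    -- descent `f y < f x` gives 321 with `k`, and two ascents give 3412.
    avoids⇒exceedancesApart : ExceedancesApart w
    avoids⇒exceedancesApart {x} {y} x<y x<fx y<fy = ℕ.≮⇒≥ λ y<fx →
      absurd y<fx (two-returns (_≤? y) (ℕ.<⇒≢ x<y ∘ cong toℕ)
        (ℕ.<⇒≤ x<y) (ℕ.<⇒≱ y<fx) ℕ.≤-refl (ℕ.<⇒≱ y<fy))
      where
      absurd : y < f x → ¬ ∃₂ λ k l → k < l × (¬ k ≤ y × f k ≤ y) × (¬ l ≤ y × f l ≤ y)
      absurd y<fx (k , l , k<l , (k≰y , fk≤y) , (l≰y , fl≤y)) with <-cmp (f k) (f l)
      ... | tri≈ _ fk≡fl _ = ℕ.<-irrefl (cong toℕ (permutation-injective w fk≡fl)) k<l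
      ... | tri> _ _ fl<fk = no321 (contains321 w (ℕ.<-trans x<y (ℕ.≰⇒> k≰y)) k<l fl<fk
              (ℕ.≤-<-trans fk≤y y<fx))
      ... | tri< fk<fl _ _ with <-cmp (f x) (f y)
      ...   | tri< fx<fy _ _ = no3412 (contains3412 w x<y (ℕ.≰⇒> k≰y) k<l fk<fl
                (ℕ.≤-<-trans fl≤y y<fx) fx<fy)
      ...   | tri≈ _ fx≡fy _ = ℕ.<-irrefl (cong toℕ (permutation-injective w fx≡fy)) x<y
      ...   | tri> _ _ fy<fx = no321 (contains321 w x<y (ℕ.≰⇒> k≰y)
                (ℕ.≤-<-trans fk≤y y<fy) fy<fx)

    avoids⇒nonExceedancesApart : NonExceedancesApart w
    avoids⇒nonExceedancesApart {x} {y} x<y fx≤x fy≤y = ℕ.≮⇒≥ λ fy<x → absurd fy<x (f x ≟ x)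
      where
      absurd : f y < x → ¬ Dec (f x ≡ x)
      -- A fixed `x` does not leave the elements at least `x`, but the exit at `y` yields
      -- `p < x < y` with `f y < f x < f p`.
      absurd fy<x (yes fx≡x) with one-return w (x ≤?_) (ℕ.<⇒≤ x<y) (ℕ.<⇒≱ fy<x)
      ... | p , x≰p , x≤fp = no321 (contains321 w p<x x<y
              (subst (f y <_) (sym fx≡x) fy<x)
              (subst (_< f p) (sym fx≡x) (≤∧≢⇒< x≤fp λ x≡fp →
                ℕ.<-irrefl (cong toℕ (permutation-injective w (trans (sym x≡fp) (sym fx≡x)))) p<x)))
        where p<x = ℕ.≰⇒> x≰p
      absurd fy<x (no fx≢x) with two-returns (x ≤?_) (ℕ.<⇒≢ x<y ∘ cong toℕ)
        ℕ.≤-refl (ℕ.<⇒≱ (≤∧≢⇒< fx≤x fx≢x)) (ℕ.<⇒≤ x<y) (ℕ.<⇒≱ fy<x)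
      ... | p , q , p<q , (x≰p , x≤fp) , (x≰q , x≤fq) with <-cmp (f p) (f q)
      ...   | tri≈ _ fp≡fq _ = ℕ.<-irrefl (cong toℕ (permutation-injective w fp≡fq)) p<q
      ...   | tri> _ _ fq<fp = no321 (contains321 w p<q (ℕ.≰⇒> x≰q)
                (ℕ.<-≤-trans (≤∧≢⇒< fx≤x fx≢x) x≤fq) fq<fp)
      ...   | tri< fp<fq _ _ with <-cmp (f x) (f y)
      ...     | tri< fx<fy _ _ = no3412 (contains3412 w p<q (ℕ.≰⇒> x≰q) x<y fx<fy
                  (ℕ.<-≤-trans fy<x x≤fp) fp<fq)
      ...     | tri≈ _ fx≡fy _ = ℕ.<-irrefl (cong toℕ (permutation-injective w fx≡fy)) x<y
      ...     | tri> _ _ fy<fx = no321 (contains321 w (ℕ.≰⇒> x≰q) x<y fy<fx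
                  (ℕ.<-≤-trans (≤∧≢⇒< fx≤x fx≢x) x≤fq))

corollary4p12 : (n : ℕ) (w : Permutation′ n) → Unimodal w ⇔ (Avoids w pattern321 × Avoids w pattern3412)
corollary4p12 n w = mk⇔
  (λ uni → let exc = unimodal⇒exceedancesApart w uni
               non = unimodal⇒nonExceedancesApart w uni
           in apart⇒avoids321 w exc non , apart⇒avoids3412 w exc non)
  (λ (no321 , no3412) → apart⇒unimodal w
    (avoids⇒exceedancesApart w no321 no3412) (avoids⇒nonExceedancesApart w no321 no3412))
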